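{- Let $(S,+)$ be a commutative semigroup, let $A\subseteq S$ be a $\mathcal{CR}$-set in $(S,+)$, and let $l\in\mathbb{N}$. Then the set $$\{(a,b)\in S\times S:\ \{a,a+b,a+2b,\ldots,a+lb\}\subseteq A\}$$ is a $\mathcal{CR}$-set in the semigroup $(S\times S,+)$ (with coordinatewise addition).
   Context: For a commutative semigroup $(S,+)$ and $r,n\in\mathbb{N}$, let $S^{r\times n}$ denote the set of $r\times n$ matrices with entries in $S$. For $M=(M_{ij})\in S^{r\times n}$ and a non-empty $\alpha\subseteq\{1,\ldots,r\}$, write $M_{\alpha j}=\sum_{i\in\alpha}M_{ij}$. A subset $A\subseteq S$ is a $\mathcal{CR}$-set (combinatorially rich set) if for every $n\in\mathbb{N}$ there exists $r\in\mathbb{N}$ such that for every $M\in S^{r\times n}$ there exist a non-empty set $\alpha\subseteq\{1,\ldots,r\}$ and $s\in S$ with $s+M_{\alpha j}\in A$ for all $j\in\{1,\ldots,n\}$. For $k\in\mathbb{N}$ and $b\in S$, $kb$ denotes $b+\cdots+b$ ($k$ times). -}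

module Defs where

open import Algebra.Bundles using (CommutativeSemigroup)
import Algebra.Construct.DirectProduct as DirectProduct
open import Data.Bool.Base using (true; false)
open import Data.Fin.Base using (Fin; zero; suc)
open import Data.Fin.Subset using (Subset; Nonempty)
open import Data.Fin.Subset.Properties using (nonempty?; drop-there)
open import Data.Nat.Base using (ℕ; zero; suc; _≤_; NonZero)
open import Data.Product.Base using (Σ; _×_; _,_; ∃-syntax)
open import Data.Vec.Base using (_∷_)
open import Data.Vec.Functional using (Vector)
open import Level using (Level; _⊔_)
open import Relation.Binary.Definitions using (_Respects_)
open import Relation.Nullary.Decidable.Core using (yes; no)
open import Relation.Unary using (Pred; _∈_)

module CR {c ℓ : Level} (S : CommutativeSemigroup c ℓ) where

  open CommutativeSemigroup S renaming (_∙_ to _+_; ∙-cong to +-cong)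

  Matrix : ℕ → ℕ → Set c
  Matrix r n = Vector (Vector Carrier n) r

  -- S need not have a zero, so the sum is defined for non-empty α only.
  ∑ : ∀ {r} (α : Subset r) → Nonempty α → Vector Carrier r → Carrier
  ∑ (false ∷ α) (suc i , i∈α) f = ∑ α (i , drop-there i∈α) (λ i → f (suc i))
  ∑ (true  ∷ α) _             f with nonempty? α
  ... | yes α≢∅ = f zero + ∑ α α≢∅ (λ i → f (suc i))
  ... | no  _   = f zero

  -- "n ∈ ℕ" and "r ∈ ℕ" range over the positive integers.
  IsCR : ∀ {p} → Pred Carrier p → Set (c ⊔ p)
  IsCR A =
    (n : ℕ) → NonZero n →
    ∃[ r ] NonZero r ×
      ((M : Matrix r n) →
        Σ (Subset r) λ α → Σ (Nonempty α) λ α≢∅ → ∃[ s ]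
          ((j : Fin n) → (s + ∑ α α≢∅ (λ i → M i j)) ∈ A))

  infixr 8 [1+_]·_
  [1+_]·_ : ℕ → Carrier → Carrier
  [1+ zero  ]· b = b
  [1+ suc k ]· b = b + [1+ k ]· b

  -- a + k b, where the term for k = 0 is a itself.
  apTerm : Carrier → Carrier → ℕ → Carrier
  apTerm a b zero    = a
  apTerm a b (suc k) = a + [1+ k ]· b

  APs : ∀ {p} → ℕ → Pred Carrier p → Pred (Carrier × Carrier) p
  APs l A (a , b) = ∀ k → k ≤ l → apTerm a b k ∈ A

  S×S : CommutativeSemigroup c ℓ
  S×S = DirectProduct.commutativeSemigroup S S

  [1+_]·-cong : ∀ k {b b′} → b ≈ b′ → [1+ k ]· b ≈ [1+ k ]· b′
  [1+ zero  ]·-cong b≈b′ = b≈b′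
  [1+ suc k ]·-cong b≈b′ = +-cong b≈b′ ([1+ k ]·-cong b≈b′)

  -- APs l A is again a subset of the setoid S × S.
  APs-resp : ∀ {p} l {A : Pred Carrier p} → A Respects _≈_ →
             APs l A Respects (CommutativeSemigroup._≈_ S×S)
  APs-resp l resp (a≈a′ , _)    ap zero    k≤l = resp a≈a′ (ap zero k≤l)
  APs-resp l resp (a≈a′ , b≈b′) ap (suc k) k≤l =
    resp (+-cong a≈a′ ([1+ k ]·-cong b≈b′)) (ap (suc k) k≤l)

{-# OPTIONS --safe #-}

-- Apply the hypothesis on A to the matrix whose columns are indexed by pairs
-- (j, k) with k ≤ l, and whose entries are x + k (c + y), where (x , y) is the
-- (i, j) entry of the given matrix over S × S and c ∈ S is fixed.  The shift by
-- c compensates for the missing zero of S: it makes b = ∑_{i ∈ α} c available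
-- as the second coordinate of the translation (s , b).
module Submission where

open import Defs
open import Algebra.Bundles using (CommutativeSemigroup)
import Algebra.Construct.DirectProduct as DirectProduct
import Algebra.Morphism.Construct.DirectProduct as DirectProductMorphism
open import Algebra.Morphism.Structures using (IsMagmaHomomorphism)
import Algebra.Properties.CommutativeSemigroup as CommutativeSemigroupProperties
open import Data.Bool.Base using (true; false)
open import Data.Fin.Base using (Fin; zero; suc; toℕ; fromℕ<; combine; remQuot)
open import Data.Fin.Properties using (remQuot-combine; toℕ-fromℕ<)
open import Data.Fin.Subset using (Subset; Nonempty)
open import Data.Fin.Subset.Properties using (nonempty?; drop-there)
open import Data.Nat.Base using (ℕ; zero; suc; s≤s; NonZero)
import Data.Nat.Base as ℕ
open import Data.Product.Base using (_×_; _,_; proj₁)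
open import Data.Vec.Base using (_∷_)
open import Data.Vec.Functional using (Vector)
open import Function.Base using (_∘_; const)
open import Level using (Level)
open import Relation.Binary.Definitions using (_Respects_)
open import Relation.Binary.PropositionalEquality.Core using (subst)
import Relation.Binary.Reasoning.Setoid as SetoidReasoning
open import Relation.Nullary.Decidable.Core using (yes; no)
open import Relation.Unary using (Pred; _∈_)

module _ {c₁ ℓ₁ c₂ ℓ₂ : Level}
         (T : CommutativeSemigroup c₁ ℓ₁) (S : CommutativeSemigroup c₂ ℓ₂) where

  private
    module T = CommutativeSemigroup T
    module S = CommutativeSemigroup S

  -- Both sums branch only on `α` and its nonemptiness, never on semigroup elements, so one
  -- induction on `α` unfolds them in parallel.
  ∑-homo : ∀ {φ} → IsMagmaHomomorphism T.rawMagma S.rawMagma φ →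
           ∀ {r} (α : Subset r) (α≢∅ : Nonempty α) (f : Vector T.Carrier r) →
           φ (CR.∑ T α α≢∅ f) S.≈ CR.∑ S α α≢∅ (φ ∘ f)
  ∑-homo φ-homo (false ∷ α) (suc i , i∈α) f =
    ∑-homo φ-homo α (i , drop-there i∈α) (f ∘ suc)
  ∑-homo φ-homo (true ∷ α) _ f with nonempty? α
  ... | yes α≢∅ = S.trans (IsMagmaHomomorphism.homo φ-homo _ _)
                          (S.∙-congˡ (∑-homo φ-homo α α≢∅ (f ∘ suc)))
  ... | no  _   = S.refl

module _ {c ℓ : Level} (S : CommutativeSemigroup c ℓ) where

  open CommutativeSemigroup S
    renaming (_∙_ to _+_; ∙-cong to +-cong; ∙-congˡ to +-congˡ; assoc to +-assoc)
  open CommutativeSemigroupProperties S using (interchange)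
  open CR S
  open SetoidReasoning setoid

  private
    S×S×S : CommutativeSemigroup c ℓ
    S×S×S = DirectProduct.commutativeSemigroup S S×S

    module S×S = CommutativeSemigroup S×S
    module S×S×S = CommutativeSemigroup S×S×S

  [1+_]·-homo : ∀ k b b′ → [1+ k ]· (b + b′) ≈ [1+ k ]· b + [1+ k ]· b′
  [1+ zero  ]·-homo b b′ = refl
  [1+ suc k ]·-homo b b′ =
    trans (+-congˡ ([1+ k ]·-homo b b′)) (interchange b b′ _ _)

  apTerm-cong : ∀ k {a a′ b b′} → a ≈ a′ → b ≈ b′ → apTerm a b k ≈ apTerm a′ b′ k
  apTerm-cong zero    a≈a′ b≈b′ = a≈a′
  apTerm-cong (suc k) a≈a′ b≈b′ = +-cong a≈a′ ([1+ k ]·-cong b≈b′)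

  apTerm-homo : ∀ k a b a′ b′ →
                apTerm (a + a′) (b + b′) k ≈ apTerm a b k + apTerm a′ b′ k
  apTerm-homo zero    a b a′ b′ = refl
  apTerm-homo (suc k) a b a′ b′ =
    trans (+-congˡ ([1+ k ]·-homo b b′)) (interchange a a′ _ _)

  apTerm-translate : ∀ k s a b → apTerm (s + a) b k ≈ s + apTerm a b k
  apTerm-translate zero    s a b = refl
  apTerm-translate (suc k) s a b = +-assoc s a _

  -- For a fixed shift `b`, sending `(x , y)` to x + k (b + y) is not additive in general: adding
  -- two values counts `b` twice. Making the shift a coordinate of the argument turns the map into a
  -- homomorphism.
  shiftedTerm : ℕ → Carrier × (Carrier × Carrier) → Carrier
  shiftedTerm k (b , (x , y)) = apTerm x (b + y) k

  shiftedTerm-isMagmaHomomorphism :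
    ∀ k → IsMagmaHomomorphism S×S×S.rawMagma rawMagma (shiftedTerm k)
  shiftedTerm-isMagmaHomomorphism k = record
    { isRelHomomorphism = record
        { cong = λ (b≈b′ , (x≈x′ , y≈y′)) → apTerm-cong k x≈x′ (+-cong b≈b′ y≈y′) }
    ; homo = λ (b , (x , y)) (b′ , (x′ , y′)) →
        trans (apTerm-cong k refl (interchange b b′ y y′))
              (apTerm-homo k x (b + y) x′ (b′ + y′))
    }

  -- For variable `α`, a sum in the product does not compute to a tuple of sums. The two projections
  -- are homomorphisms, so `∑-homo` splits it; a third use moves `shiftedTerm k` inside.
  ∑-shiftedTerm : ∀ k {r} (α : Subset r) (α≢∅ : Nonempty α)
                  (g : Vector Carrier r) (f : Vector (Carrier × Carrier) r) →
                  shiftedTerm k (∑ α α≢∅ g , CR.∑ S×S α α≢∅ f) ≈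
                  ∑ α α≢∅ (λ i → shiftedTerm k (g i , f i))
  ∑-shiftedTerm k α α≢∅ g f = begin
    shiftedTerm k (∑ α α≢∅ g , CR.∑ S×S α α≢∅ f)
      ≈⟨ IsMagmaHomomorphism.⟦⟧-cong (shiftedTerm-isMagmaHomomorphism k)
           ( ∑-homo S×S×S S (Proj₁.isMagmaHomomorphism refl) α α≢∅ gf
           , ∑-homo S×S×S S×S (Proj₂.isMagmaHomomorphism S×S.refl) α α≢∅ gf) ⟨
    shiftedTerm k (CR.∑ S×S×S α α≢∅ gf)
      ≈⟨ ∑-homo S×S×S S (shiftedTerm-isMagmaHomomorphism k) α α≢∅ gf ⟩
    ∑ α α≢∅ (shiftedTerm k ∘ gf) ∎
    where
    gf = λ i → g i , f i
    open DirectProductMorphism.Magma rawMagma S×S.rawMagma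

  module _ {p : Level} {A : Pred Carrier p} (resp : A Respects _≈_) where

    APs-isCR : IsCR A → ∀ l → CR.IsCR S×S (APs l A)
    -- Each `j` needs `suc l` columns, for k = 0, ..., l. With `n` a successor the product computes
    -- to a successor, so its `NonZero` proof is inferred.
    APs-isCR A-CR l n@(suc _) n≢0 with A-CR (n ℕ.* suc l) _
    ... | r@(suc _) , r≢0 , rich = r , r≢0 , λ M →
      let
        -- Any element of the carrier would do. The carrier might be empty, so one is read off `M`,
        -- which has a first entry because `r` and `n` are successors.
        c = proj₁ (M zero zero)
        entry = λ i (j , k) → shiftedTerm (toℕ k) (c , M i j)
        α , α≢∅ , s , s+∑∈A = rich (λ i → entry i ∘ remQuot (suc l))
        b = ∑ α α≢∅ (const c)
        column : ∀ j (k : Fin (suc l)) → s + ∑ α α≢∅ (λ i → entry i (j , k)) ∈ A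
        column j k = subst (λ q → s + ∑ α α≢∅ (λ i → entry i q) ∈ A)
                           (remQuot-combine j k) (s+∑∈A (combine j k))
        -- Passes from `Fin (suc l)`, which indexes the columns, to the bounded naturals used in
        -- `APs`.
        row : ∀ j k → k ℕ.≤ l → s + ∑ α α≢∅ (λ i → shiftedTerm k (c , M i j)) ∈ A
        row j k k≤l = subst (λ m → s + ∑ α α≢∅ (λ i → shiftedTerm m (c , M i j)) ∈ A)
                            (toℕ-fromℕ< (s≤s k≤l)) (column j (fromℕ< (s≤s k≤l)))
      in
      α , α≢∅ , (s , b) , λ j k k≤l →
        -- The goal is the term at (`s` + ∑ x, `b` + ∑ y): first `s` is pulled out, then what
        -- remains is `shiftedTerm k` of the three sums, with `b` as the sum of the shifts.
        resp (sym (trans (apTerm-translate k s _ _)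
                         (+-congˡ (∑-shiftedTerm k α α≢∅ (const c) (λ i → M i j)))))
             (row j k k≤l)

theorem8 : {c ℓ p : Level} (S : CommutativeSemigroup c ℓ) →
    let open CommutativeSemigroup S in
    (A : Pred Carrier p) → A Respects _≈_ → CR.IsCR S A →
    (l : ℕ) → NonZero l →
    CR.IsCR (CR.S×S S) (CR.APs S l A)
theorem8 S A resp A-CR l _ = APs-isCR S resp A-CR l
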